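{- For every tree $T$, $$a(T)-\alpha(T)\le \frac{\mu(T)}{2}-\frac12 .$$
   Context: All graphs are finite, undirected, without loops or multiple edges. For a graph $G$, $m(G)$ is its number of edges, $\alpha(G)$ is its independence number (maximum size of a set of pairwise non-adjacent vertices), and $\mu(G)$ is its matching number (maximum size of a set of edges no two of which share a vertex). If $d_1\le d_2\le\cdots\le d_n$ is the degree sequence of $G$, the annihilation number $a(G)$ is the largest integer $k$ such that $\sum_{i=1}^k d_i\le m(G)$.
   Formalization: The tree is assumed to have at least two vertices; for the one-vertex tree the claim is false, since there a = 1, α = 1 and μ = 0 would give 0 ≤ −1/2. -}

module Defs where

open import Data.Bool.Base using (if_then_else_)
open import Data.Fin.Base using (Fin)
open import Data.Fin.Properties using (_≟_; _<?_; all?)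
open import Data.Fin.Subset using (Subset; _∈_; ∣_∣)
open import Data.Fin.Subset.Properties using (_∈?_; anySubset?)
open import Data.List.Base
  using (List; []; _∷_; _∷ʳ_; allFin; cartesianProduct; filter; length; lookup; map; take)
open import Data.List.Relation.Unary.Linked using (Linked)
open import Data.List.Relation.Unary.Unique.Propositional using (Unique)
open import Data.List.Sort using (sort)
open import Data.Nat.Base using (ℕ; zero; suc; _≤_; _<_)
open import Data.Nat.ListAction using (sum)
import Data.Nat.Properties as ℕ
open import Data.Product.Base using (_×_; _,_; ∃)
open import Level using (0ℓ)
open import Relation.Binary.Construct.Closure.ReflexiveTransitive using (Star)
open import Relation.Binary.Core using (Rel)
open import Relation.Binary.Definitions using (Symmetric; Irreflexive)
import Relation.Binary.Definitions as Binary
open import Relation.Binary.PropositionalEquality using (_≡_; _≢_)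
open import Relation.Nullary.Decidable using (does; _×-dec_; _→-dec_; ¬?)
open import Relation.Nullary.Negation using (¬_)
open import Relation.Unary using (Pred; Decidable)

record Graph (n : ℕ) : Set₁ where
  infix 4 _~_ _~?_
  field
    _~_    : Rel (Fin n) 0ℓ
    _~?_   : Binary.Decidable _~_
    symm   : Symmetric _~_
    irrefl : Irreflexive _≡_ _~_

-- The greatest k ≤ N satisfying P.  The value 0 is also returned when no
-- such k exists, but every use below has P 0.
greatest≤ : ℕ → {P : Pred ℕ 0ℓ} → Decidable P → ℕ
greatest≤ zero    P? = zero
greatest≤ (suc N) P? = if does (P? (suc N)) then suc N else greatest≤ N P?

module _ {n : ℕ} (G : Graph n) where
  open Graph G

  degree : Fin n → ℕ
  degree v = length (filter (v ~?_) (allFin n))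

  -- Each edge {u , v} occurs exactly once, as the pair with u < v.
  edges : List (Fin n × Fin n)
  edges = filter (λ (u , v) → (u <? v) ×-dec (u ~? v))
                 (cartesianProduct (allFin n) (allFin n))

  m : ℕ
  m = length edges

  Independent : Subset n → Set
  Independent S = ∀ u v → u ∈ S → v ∈ S → ¬ (u ~ v)

  independent? : Decidable Independent
  independent? S = all? λ u → all? λ v →
    (u ∈? S) →-dec ((v ∈? S) →-dec ¬? (u ~? v))

  α : ℕ
  α = greatest≤ n {λ k → ∃ λ S → Independent S × ∣ S ∣ ≡ k}
        λ k → anySubset? λ S → independent? S ×-dec (∣ S ∣ ℕ.≟ k)

  VertexDisjoint : Rel (Fin n × Fin n) 0ℓ
  VertexDisjoint (u , v) (x , y) = u ≢ x × u ≢ y × v ≢ x × v ≢ y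

  vertexDisjoint? : Binary.Decidable VertexDisjoint
  vertexDisjoint? (u , v) (x , y) =
    ¬? (u ≟ x) ×-dec ¬? (u ≟ y) ×-dec ¬? (v ≟ x) ×-dec ¬? (v ≟ y)

  -- A set of edges is given by the set of their positions in edges.
  Matching : Subset m → Set
  Matching M = ∀ e f → e ∈ M → f ∈ M → e ≢ f →
    VertexDisjoint (lookup edges e) (lookup edges f)

  matching? : Decidable Matching
  matching? M = all? λ e → all? λ f →
    (e ∈? M) →-dec ((f ∈? M) →-dec (¬? (e ≟ f) →-dec
      vertexDisjoint? (lookup edges e) (lookup edges f)))

  μ : ℕ
  μ = greatest≤ m {λ k → ∃ λ M → Matching M × ∣ M ∣ ≡ k}
        λ k → anySubset? λ M → matching? M ×-dec (∣ M ∣ ℕ.≟ k)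

  degreeSequence : List ℕ
  degreeSequence = sort ℕ.≤-decTotalOrder (map degree (allFin n))

  a : ℕ
  a = greatest≤ n {λ k → sum (take k degreeSequence) ≤ m}
        λ k → sum (take k degreeSequence) ℕ.≤? m

  Connected : Set
  Connected = ∀ u v → Star _~_ u v

  -- The closed walk v , vs , v is a cycle; its length is 1 + length vs.
  IsCycle : Fin n → List (Fin n) → Set
  IsCycle v vs = Linked _~_ (v ∷ (vs ∷ʳ v)) × Unique (v ∷ vs) × 2 ≤ length vs

  Acyclic : Set
  Acyclic = ∀ v vs → ¬ IsCycle v vs

  record IsTree : Set where
    field
      nonempty  : 0 < n
      connected : Connected
      acyclic   : Acyclic

{-# OPTIONS --safe #-}
module Submission where

-- Let L be a set of a(T) vertices with degree sum at most m, and let H be its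
-- complement.  The degree sum over L counts the edges inside L twice and those
-- between L and H once, while m counts these and the edges inside H once; hence
-- e(L) ≤ e(H), and e(H) ≤ |H| − 1 because H is nonempty and spans a forest.
-- Deleting one endpoint of each edge inside L leaves an independent set, so
-- α ≥ |L| − e(L) ≥ a − (n − a − 1).  Kőnig's inequality n ≤ α + μ, which in a
-- forest follows by removing leaves, then gives 2α + μ ≥ 2a + 1.

open import Defs
open import Data.Nat.Base using (ℕ) renaming (_≤_ to _≤ⁿ_)
open import Data.Integer.Base using (+_)
open import Data.Rational.Unnormalised.Base using (_/_; _-_; _≤_; ½)

open import Data.Bool.Base using (true; false)
open import Data.Fin.Base as Fin using (Fin)
open import Data.Fin.Properties using (_≟_; _<?_; <-cmp)
open import Data.Fin.Subset as Subset using (Subset; ∣_∣; ⁅_⁆; _∪_; ⊥)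
import Data.Fin.Subset.Properties as Subset
open import Data.List.Base
  using (List; []; _∷_; [_]; _++_; _∷ʳ_; allFin; cartesianProduct; drop; filter; length; lookup; map; take)
open import Data.List.Membership.Propositional using (_∈_; _∉_; find)
open import Data.List.Membership.Propositional.Properties
  using (∈-∃++; ∈-allFin; ∈-cartesianProduct⁺; ∈-filter⁺; ∈-filter⁻; ∈-length; ∈-tabulate⁺)
import Data.List.Membership.DecPropositional as DecMembership
import Data.List.Properties as List
open import Data.List.Relation.Binary.Permutation.Propositional
  using (_↭_; refl; prep; swap; trans; ↭-sym; ↭-trans; ↭⇒↭ₛ)
open import Data.List.Relation.Binary.Permutation.Propositional.Properties
  using (∈-resp-↭; ↭-length; ↭-map-inv; filter-↭; shift)
import Data.List.Relation.Binary.Permutation.Setoid.Properties as Permutationₛ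
open import Data.List.Relation.Unary.All as All using (All; []; _∷_)
import Data.List.Relation.Unary.All.Properties as All
open import Data.List.Relation.Unary.AllPairs as AllPairs using (AllPairs; []; _∷_)
import Data.List.Relation.Unary.AllPairs.Properties as AllPairsₚ
open import Data.List.Relation.Unary.Any using (here; there; any?; index)
open import Data.List.Relation.Unary.Any.Properties using (lookup-index)
open import Data.List.Relation.Unary.Linked using (Linked; []; [-]; _∷_)
open import Data.List.Relation.Unary.Unique.Propositional using (Unique)
import Data.List.Relation.Unary.Unique.Propositional.Properties as Unique
open import Data.List.Sort using (sort-↭)
import Data.Integer.Base as ℤ
import Data.Integer.Properties as ℤ
import Data.Integer.Tactic.RingSolver as ℤ-Solver
open import Data.Nat.Base using (zero; suc; _+_; _<_; z≤n; s≤s; s≤s⁻¹)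
open import Data.Nat.ListAction using (sum)
import Data.Nat.Properties as ℕ
open import Data.Nat.Tactic.RingSolver using (solve-∀)
open import Data.Product.Base using (∃; ∃₂; _×_; _,_; proj₁; proj₂)
open import Data.Rational.Unnormalised.Base using (*≤*)
open import Data.Sum.Base using (inj₁; inj₂)
open import Data.Vec.Base using ([]; _∷_; here; there)
open import Function.Base using (_∘_; _on_; id)
open import Level using (0ℓ)
open import Relation.Binary.Construct.Closure.ReflexiveTransitive using (_◅_)
open import Relation.Binary.Core using (Rel)
open import Relation.Binary.Definitions using (Symmetric; tri<; tri≈; tri>)
open import Relation.Binary.PropositionalEquality
  using (_≡_; _≢_; refl; sym; cong; cong₂; subst; setoid; module ≡-Reasoning)
  renaming (trans to ≡-trans)
open import Relation.Nullary using (¬_; yes; no; contradiction; _×-dec_)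
open import Relation.Unary using (Pred; Decidable; _⊆_)

private variable
  A B : Set
  k n : ℕ

-- Bounded maxima.

greatest≤-upper : ∀ N {P : Pred ℕ 0ℓ} (P? : Decidable P) → P k → k ≤ⁿ N → k ≤ⁿ greatest≤ N P?
greatest≤-upper zero    P? Pk k≤0 = k≤0
greatest≤-upper (suc N) P? Pk k≤N with P? (suc N)
... | yes _  = k≤N
... | no ¬PN with ℕ.m≤n⇒m<n∨m≡n k≤N
...   | inj₁ (s≤s k≤N′) = greatest≤-upper N P? Pk k≤N′
...   | inj₂ refl       = contradiction Pk ¬PN

greatest≤-satisfies : ∀ N {P : Pred ℕ 0ℓ} (P? : Decidable P) → P 0 → P (greatest≤ N P?)
greatest≤-satisfies zero    P? P0 = P0
greatest≤-satisfies (suc N) P? P0 with P? (suc N)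
... | yes PN = PN
... | no _   = greatest≤-satisfies N P? P0

greatest≤-≤ : ∀ N {P : Pred ℕ 0ℓ} (P? : Decidable P) → greatest≤ N P? ≤ⁿ N
greatest≤-≤ zero    P? = z≤n
greatest≤-≤ (suc N) P? with P? (suc N)
... | yes _ = ℕ.≤-refl
... | no _  = ℕ.m≤n⇒m≤1+n (greatest≤-≤ N P?)

-- Permutations, pairwise relations and filters on lists.

∈⇒↭∷ : {x : A} {xs : List A} → x ∈ xs → ∃ λ ys → xs ↭ x ∷ ys
∈⇒↭∷ x∈xs with as , bs , refl ← ∈-∃++ x∈xs = as ++ bs , shift _ as bs

Unique-resp-↭ : {xs ys : List A} → xs ↭ ys → Unique xs → Unique ys
Unique-resp-↭ xs↭ys = Permutationₛ.Unique-resp-↭ (setoid _) (↭⇒↭ₛ xs↭ys)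

AllPairs-++⁻ˡ : {R : Rel A 0ℓ} (xs : List A) {ys : List A} → AllPairs R (xs ++ ys) → AllPairs R xs
AllPairs-++⁻ˡ []       _          = []
AllPairs-++⁻ˡ (x ∷ xs) (px ∷ pxs) = All.++⁻ˡ xs px ∷ AllPairs-++⁻ˡ xs pxs

AllPairs-lookup : {R : Rel A 0ℓ} → Symmetric R → {xs : List A} → AllPairs R xs →
  ∀ {x y} → x ∈ xs → y ∈ xs → x ≢ y → R x y
AllPairs-lookup R-sym (px ∷ pxs) (here refl)  (here refl)  x≢y = contradiction refl x≢y
AllPairs-lookup R-sym (px ∷ pxs) (here refl)  (there y∈)   x≢y = All.lookup px y∈
AllPairs-lookup R-sym (px ∷ pxs) (there x∈)   (here refl)  x≢y = R-sym (All.lookup px x∈)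
AllPairs-lookup R-sym (px ∷ pxs) (there x∈)   (there y∈)   x≢y = AllPairs-lookup R-sym pxs x∈ y∈ x≢y

-- Cuts a path off just after an occurrence of `y`; this yields the arc of a cycle when a path meets
-- itself.
Linked-++⁻∷ʳ : {R : Rel A 0ℓ} (xs : List A) {y : A} {ys : List A} →
  Linked R (xs ++ y ∷ ys) → Linked R (xs ∷ʳ y)
Linked-++⁻∷ʳ []            _        = [-]
Linked-++⁻∷ʳ (_ ∷ [])      (r ∷ _)  = r ∷ [-]
Linked-++⁻∷ʳ (_ ∷ x ∷ xs)  (r ∷ rs) = r ∷ Linked-++⁻∷ʳ (x ∷ xs) rs

length-filter-⊆ : {P Q : Pred A 0ℓ} (P? : Decidable P) (Q? : Decidable Q) → P ⊆ Q →
  ∀ xs → length (filter P? xs) ≤ⁿ length (filter Q? xs)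
length-filter-⊆ P? Q? P⊆Q []       = z≤n
length-filter-⊆ P? Q? P⊆Q (x ∷ xs) with ih ← length-filter-⊆ P? Q? P⊆Q xs | P? x | Q? x
... | yes _ | yes _  = s≤s ih
... | yes p | no ¬q  = contradiction (P⊆Q p) ¬q
... | no _  | yes _  = ℕ.m≤n⇒m≤1+n ih
... | no _  | no _   = ih

length-filter-map : {P : Pred B 0ℓ} (P? : Decidable P) (f : A → B) →
  ∀ xs → length (filter P? (map f xs)) ≡ length (filter (P? ∘ f) xs)
length-filter-map P? f []       = refl
length-filter-map P? f (x ∷ xs) with P? (f x)
... | yes _ = cong suc (length-filter-map P? f xs)
... | no _  = length-filter-map P? f xs

-- Duplicate-free lists as subsets of `Fin n`.

fromList : List (Fin n) → Subset n
fromList []       = ⊥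
fromList (x ∷ xs) = ⁅ x ⁆ ∪ fromList xs

∈-fromList⁻ : ∀ (xs : List (Fin n)) {x} → x Subset.∈ fromList xs → x ∈ xs
∈-fromList⁻ []       x∈ = contradiction x∈ Subset.∉⊥
∈-fromList⁻ (y ∷ xs) x∈ with Subset.x∈p∪q⁻ ⁅ y ⁆ (fromList xs) x∈
... | inj₁ x∈⁅y⁆ = here (Subset.x∈⁅y⁆⇒x≡y y x∈⁅y⁆)
... | inj₂ x∈xs  = there (∈-fromList⁻ xs x∈xs)

∣⁅x⁆∪p∣≡1+∣p∣ : ∀ {x : Fin n} {p} → x Subset.∉ p → ∣ ⁅ x ⁆ ∪ p ∣ ≡ suc ∣ p ∣
∣⁅x⁆∪p∣≡1+∣p∣ {x = Fin.zero}  {true  ∷ p} x∉p = contradiction here x∉p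
∣⁅x⁆∪p∣≡1+∣p∣ {x = Fin.zero}  {false ∷ p} x∉p = cong (suc ∘ ∣_∣) (Subset.∪-identityˡ p)
∣⁅x⁆∪p∣≡1+∣p∣ {x = Fin.suc x} {true  ∷ p} x∉p = cong suc (∣⁅x⁆∪p∣≡1+∣p∣ (x∉p ∘ there))
∣⁅x⁆∪p∣≡1+∣p∣ {x = Fin.suc x} {false ∷ p} x∉p = ∣⁅x⁆∪p∣≡1+∣p∣ (x∉p ∘ there)

∣fromList∣ : ∀ {xs : List (Fin n)} → Unique xs → ∣ fromList xs ∣ ≡ length xs
∣fromList∣ {n = n} []             = Subset.∣⊥∣≡0 n
∣fromList∣ {xs = x ∷ xs} (x∉ ∷ xs!) = ≡-trans
  (∣⁅x⁆∪p∣≡1+∣p∣ λ x∈ → All.lookup x∉ (∈-fromList⁻ xs x∈) refl)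
  (cong suc (∣fromList∣ xs!))

-- The pigeonhole principle. It keeps independent sets and matchings within the search ranges of `α`
-- and `μ`, and limits the length of paths.
Unique⇒length≤ : ∀ {xs : List (Fin n)} → Unique xs → length xs ≤ⁿ n
Unique⇒length≤ {xs = xs} xs! = subst (_≤ⁿ _) (∣fromList∣ xs!) (Subset.∣p∣≤n (fromList xs))

-- Double counting of edges.

module Counting {n : ℕ} (G : Graph n) where
  open Graph G

  degreeIn : Fin n → List (Fin n) → ℕ
  degreeIn v xs = length (filter (v ~?_) xs)

  -- In a duplicate-free list each induced edge is counted once, at whichever endpoint comes first
  -- in the list.
  edgesIn : List (Fin n) → ℕ
  edgesIn []       = 0
  edgesIn (x ∷ xs) = degreeIn x xs + edgesIn xs

  -- Counts ordered pairs, so edges inside both lists are counted twice.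
  edgesBetween : List (Fin n) → List (Fin n) → ℕ
  edgesBetween xs ys = sum (map (λ x → degreeIn x ys) xs)

  degreeIn-++ : ∀ v xs ys → degreeIn v (xs ++ ys) ≡ degreeIn v xs + degreeIn v ys
  degreeIn-++ v xs ys = ≡-trans (cong length (List.filter-++ (v ~?_) xs ys))
                                (List.length-++ (filter (v ~?_) xs))

  degreeIn-↭ : ∀ v {xs ys} → xs ↭ ys → degreeIn v xs ≡ degreeIn v ys
  degreeIn-↭ v xs↭ys = ↭-length (filter-↭ (v ~?_) xs↭ys)

  -- `degreeIn x [ y ]` is the 0-1 entry of the adjacency matrix at `x`, `y`.
  degreeIn-sym : ∀ x y → degreeIn x [ y ] ≡ degreeIn y [ x ]
  degreeIn-sym x y with x ~? y | y ~? x
  ... | yes _   | yes _   = refl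
  ... | yes x~y | no ¬y~x = contradiction (symm x~y) ¬y~x
  ... | no ¬x~y | yes y~x = contradiction (symm y~x) ¬x~y
  ... | no _    | no _    = refl

  degreeIn-self : ∀ x xs → degreeIn x (x ∷ xs) ≡ degreeIn x xs
  degreeIn-self x xs = cong length (List.filter-reject (x ~?_) {xs = xs} (irrefl refl))

  degreeIn-adj : ∀ {x y} xs → x ~ y → degreeIn x (y ∷ xs) ≡ suc (degreeIn x xs)
  degreeIn-adj {x} xs x~y = cong length (List.filter-accept (x ~?_) {xs = xs} x~y)

  ∈⇒0<degreeIn : ∀ {x y xs} → y ∈ xs → x ~ y → 0 < degreeIn x xs
  ∈⇒0<degreeIn {x} y∈ x~y = ∈-length (∈-filter⁺ (x ~?_) y∈ x~y)

  degreeIn≡0⇒≁ : ∀ {x xs} → degreeIn x xs ≡ 0 → All (λ y → ¬ x ~ y) xs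
  degreeIn≡0⇒≁ d≡0 = All.tabulate λ y∈ x~y → ℕ.<⇒≢ (∈⇒0<degreeIn y∈ x~y) (sym d≡0)

  neighbour : ∀ {x} xs {d} → degreeIn x xs ≡ suc d → ∃ λ y → y ∈ xs × x ~ y
  neighbour {x} xs eq with filter (x ~?_) xs in eq′
  ... | y ∷ _ = y , ∈-filter⁻ (x ~?_) (subst (y ∈_) (sym eq′) (here refl))

  -- The first two entries of the filtered list are distinct, so at most one of them is `z`.
  neighbour-≢ : ∀ {x xs} → Unique xs → 2 ≤ⁿ degreeIn x xs → ∀ z → ∃ λ y → y ∈ xs × x ~ y × y ≢ z
  neighbour-≢ {x} {xs} xs! 2≤d z with filter (x ~?_) xs in eq | Unique.filter⁺ (x ~?_) xs!
  neighbour-≢ {x} {xs} xs! (s≤s ()) z | _ ∷ [] | _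
  ... | y₁ ∷ y₂ ∷ _ | (y₁≢y₂ ∷ _) ∷ _ with y₁ ≟ z
  ...   | no y₁≢z  = let y∈ , x~y = ∈-filter⁻ (x ~?_) {xs = xs} (subst (y₁ ∈_) (sym eq) (here refl))
                     in y₁ , y∈ , x~y , y₁≢z
  ...   | yes refl = let y∈ , x~y = ∈-filter⁻ (x ~?_) {xs = xs} (subst (y₂ ∈_) (sym eq) (there (here refl)))
                     in y₂ , y∈ , x~y , y₁≢y₂ ∘ sym

  -- Splits off the column of `y` in the adjacency matrix, where the definition splits off rows;
  -- symmetry makes the column sum a degree.
  edgesBetween-∷ʳ : ∀ xs y ys → edgesBetween xs (y ∷ ys) ≡ degreeIn y xs + edgesBetween xs ys
  edgesBetween-∷ʳ []       y ys = refl
  edgesBetween-∷ʳ (x ∷ xs) y ys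
    rewrite degreeIn-++ x [ y ] ys | degreeIn-++ y [ x ] xs | degreeIn-sym x y | edgesBetween-∷ʳ xs y ys
    = interchange (degreeIn y [ x ]) _ _ _
    where
    interchange : ∀ a b c d → (a + b) + (c + d) ≡ (a + c) + (b + d)
    interchange = solve-∀

  edgesBetween-++ʳ : ∀ xs ys zs → edgesBetween xs (ys ++ zs) ≡ edgesBetween xs ys + edgesBetween xs zs
  edgesBetween-++ʳ xs []       zs = cong (_+ edgesBetween xs zs) (sym (edgesBetween-[] xs))
    where
    edgesBetween-[] : ∀ xs → edgesBetween xs [] ≡ 0
    edgesBetween-[] []       = refl
    edgesBetween-[] (_ ∷ xs) = edgesBetween-[] xs
  edgesBetween-++ʳ xs (y ∷ ys) zs
    rewrite edgesBetween-∷ʳ xs y (ys ++ zs) | edgesBetween-∷ʳ xs y ys | edgesBetween-++ʳ xs ys zs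
    = sym (ℕ.+-assoc (degreeIn y xs) _ _)

  edgesBetween-↭ʳ : ∀ xs {ys zs} → ys ↭ zs → edgesBetween xs ys ≡ edgesBetween xs zs
  edgesBetween-↭ʳ xs ys↭zs = cong sum (List.map-cong (λ x → degreeIn-↭ x ys↭zs) xs)

  -- A new head adds its row and its column, which have the same sum; its diagonal entry vanishes
  -- because there are no loops.
  handshake : ∀ xs → edgesBetween xs xs ≡ edgesIn xs + edgesIn xs
  handshake []       = refl
  handshake (x ∷ xs)
    rewrite degreeIn-self x xs | edgesBetween-∷ʳ xs x xs | handshake xs
    = rearrange (degreeIn x xs) (edgesIn xs)
    where
    rearrange : ∀ d e → d + (d + (e + e)) ≡ (d + e) + (d + e)
    rearrange = solve-∀

  edgesIn-++ : ∀ xs ys → edgesIn (xs ++ ys) ≡ edgesIn xs + edgesBetween xs ys + edgesIn ys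
  edgesIn-++ []       ys = refl
  edgesIn-++ (x ∷ xs) ys rewrite degreeIn-++ x xs ys | edgesIn-++ xs ys
    = rearrange (degreeIn x xs) (degreeIn x ys) (edgesIn xs) (edgesBetween xs ys) (edgesIn ys)
    where
    rearrange : ∀ a b c d e → (a + b) + (c + d + e) ≡ (a + c) + (b + d) + e
    rearrange = solve-∀

  -- A swap only changes the endpoint at which the pair `x`, `y` is counted, so `degreeIn-sym`
  -- settles it.
  edgesIn-↭ : ∀ {xs ys} → xs ↭ ys → edgesIn xs ≡ edgesIn ys
  edgesIn-↭ refl           = refl
  edgesIn-↭ (prep x p)     = cong₂ _+_ (degreeIn-↭ x p) (edgesIn-↭ p)
  edgesIn-↭ (trans p q)    = ≡-trans (edgesIn-↭ p) (edgesIn-↭ q)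
  edgesIn-↭ (swap {xs} {ys} x y p)
    rewrite degreeIn-++ x [ y ] xs | degreeIn-++ y [ x ] ys | degreeIn-sym x y
          | degreeIn-↭ x p | degreeIn-↭ y p | edgesIn-↭ p
    = rearrange (degreeIn y [ x ]) _ _ _
    where
    rearrange : ∀ a b c d → (a + b) + (c + d) ≡ (a + c) + (b + d)
    rearrange = solve-∀

  -- With e, b, f for the edges inside `xs`, between the lists and inside `ys`, the hypothesis reads
  -- 2e + b ≤ e + b + f.
  edgesIn-comparison : ∀ xs ys → edgesBetween xs (xs ++ ys) ≤ⁿ edgesIn (xs ++ ys) →
    edgesIn xs ≤ⁿ edgesIn ys
  edgesIn-comparison xs ys le
    rewrite edgesBetween-++ʳ xs xs ys | edgesIn-++ xs ys | handshake xs
    = ℕ.+-cancelˡ-≤ (edgesIn xs + edgesBetween xs ys) _ _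
        (subst (_≤ⁿ edgesIn xs + edgesBetween xs ys + edgesIn ys) (rearrange (edgesIn xs) (edgesBetween xs ys)) le)
    where
    rearrange : ∀ e b → e + e + b ≡ e + b + e
    rearrange = solve-∀

  -- Comparison with the number of edges `m`.

  ForwardEdge : Pred (Fin n × Fin n) 0ℓ
  ForwardEdge (u , v) = u Fin.< v × u ~ v

  forwardEdge? : Decidable ForwardEdge
  forwardEdge? (u , v) = (u <? v) ×-dec (u ~? v)

  -- Generalises `m G`, which is the case of `allFin n` twice, so that induction on the two lists is
  -- possible.
  forwardEdges : List (Fin n) → List (Fin n) → ℕ
  forwardEdges xs ys = length (filter forwardEdge? (cartesianProduct xs ys))

  forwardEdges-∷ˡ : ∀ x xs ys → forwardEdges (x ∷ xs) ys ≡
    length (filter (λ y → forwardEdge? (x , y)) ys) + forwardEdges xs ys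
  forwardEdges-∷ˡ x xs ys = begin
    length (filter forwardEdge? (map (x ,_) ys ++ cartesianProduct xs ys))
      ≡⟨ cong length (List.filter-++ forwardEdge? (map (x ,_) ys) _) ⟩
    length (filter forwardEdge? (map (x ,_) ys) ++ filter forwardEdge? (cartesianProduct xs ys))
      ≡⟨ List.length-++ (filter forwardEdge? (map (x ,_) ys)) ⟩
    length (filter forwardEdge? (map (x ,_) ys)) + forwardEdges xs ys
      ≡⟨ cong (_+ _) (length-filter-map forwardEdge? (x ,_) ys) ⟩
    length (filter (λ y → forwardEdge? (x , y)) ys) + forwardEdges xs ys ∎
    where open ≡-Reasoning

  forwardEdges-∷ʳ : ∀ {y xs} → All (y Fin.<_) xs → ∀ ys → forwardEdges xs (y ∷ ys) ≡ forwardEdges xs ys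
  forwardEdges-∷ʳ []                        ys = refl
  forwardEdges-∷ʳ {y} {x ∷ xs} (y<x ∷ y<xs) ys
    rewrite forwardEdges-∷ˡ x xs (y ∷ ys) | forwardEdges-∷ˡ x xs ys
          | List.filter-reject (λ z → forwardEdge? (x , z)) {y} {ys} (λ (x<y , _) → ℕ.<-asym x<y y<x)
    = cong₂ _+_ refl (forwardEdges-∷ʳ y<xs ys)

  -- In an increasing list the head contributes only pairs in which it comes first, and their second
  -- entries are neighbours of it further on.
  forwardEdges≤edgesIn : ∀ {xs} → AllPairs Fin._<_ xs → forwardEdges xs xs ≤ⁿ edgesIn xs
  forwardEdges≤edgesIn []                          = z≤n
  forwardEdges≤edgesIn {x ∷ xs} (x<xs ∷ xs-sorted)
    rewrite forwardEdges-∷ˡ x xs (x ∷ xs) | forwardEdges-∷ʳ x<xs xs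
          | List.filter-reject (λ z → forwardEdge? (x , z)) {x} {xs} (λ (_ , x~x) → irrefl refl x~x)
    = ℕ.+-mono-≤ (length-filter-⊆ _ (x ~?_) proj₂ xs) (forwardEdges≤edgesIn xs-sorted)

  m≤edgesIn-allFin : m G ≤ⁿ edgesIn (allFin n)
  m≤edgesIn-allFin = forwardEdges≤edgesIn (AllPairsₚ.tabulate⁺-< λ i<j → i<j)

  -- Lists witnessing lower bounds on `α` and `μ`.

  -- Distinctness is included so that `AllPairs NonAdjacent` gives both independence and the absence
  -- of duplicates.
  NonAdjacent : Rel (Fin n) 0ℓ
  NonAdjacent u v = u ≢ v × ¬ u ~ v

  NonAdjacent-sym : Symmetric NonAdjacent
  NonAdjacent-sym (u≢v , u≁v) = u≢v ∘ sym , u≁v ∘ symm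

  length≤α : ∀ {S} → AllPairs NonAdjacent S → length S ≤ⁿ α G
  length≤α {S} S-ind = greatest≤-upper n _ (fromList S , independent , ∣fromList∣ S!) (Unique⇒length≤ S!)
    where
    S! : Unique S
    S! = AllPairs.map proj₁ S-ind
    independent : Independent G (fromList S)
    independent u v u∈ v∈ u~v with u ≟ v
    ... | yes u≡v = irrefl u≡v u~v
    ... | no u≢v  = proj₂ (AllPairs-lookup NonAdjacent-sym S-ind (∈-fromList⁻ S u∈) (∈-fromList⁻ S v∈) u≢v) u~v

  VertexDisjoint-sym : Symmetric (VertexDisjoint G)
  VertexDisjoint-sym (p , q , r , s) = p ∘ sym , r ∘ sym , q ∘ sym , s ∘ sym

  EdgeDisjoint : Rel (Fin (m G)) 0ℓ
  EdgeDisjoint = VertexDisjoint G on lookup (edges G)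

  length≤μ : ∀ {M} → AllPairs EdgeDisjoint M → length M ≤ⁿ μ G
  length≤μ {M} M-dis = greatest≤-upper (m G) _ (fromList M , matching , ∣fromList∣ M!) (Unique⇒length≤ M!)
    where
    M! : Unique M
    -- No edge is disjoint from itself, so pairwise disjointness excludes repetitions.
    M! = AllPairs.map (λ where (u≢u , _) refl → u≢u refl) M-dis
    matching : Matching G (fromList M)
    matching e f e∈ f∈ =
      AllPairs-lookup VertexDisjoint-sym M-dis (∈-fromList⁻ M e∈) (∈-fromList⁻ M f∈)

  Ends : Pred (Fin n) 0ℓ → Pred (Fin (m G)) 0ℓ
  Ends P e = P (proj₁ (lookup (edges G) e)) × P (proj₂ (lookup (edges G) e))

  -- Quantifying over P hides which endpoint of the edge comes first.
  adjacent⇒edge : ∀ {x y} → x ~ y → ∃ λ e → ∀ (P : Pred (Fin n) 0ℓ) → P x → P y → Ends P e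
  adjacent⇒edge {x} {y} x~y with <-cmp x y
  ... | tri≈ _ x≡y _ = contradiction x~y (irrefl x≡y)
  ... | tri< x<y _ _ = index e∈ , λ P Px Py →
    subst (λ (u , v) → P u × P v) (lookup-index e∈) (Px , Py)
    where
    e∈ : (x , y) ∈ edges G
    e∈ = ∈-filter⁺ forwardEdge? (∈-cartesianProduct⁺ (∈-allFin x) (∈-allFin y)) (x<y , x~y)
  ... | tri> _ _ y<x = index e∈ , λ P Px Py →
    subst (λ (u , v) → P u × P v) (lookup-index e∈) (Py , Px)
    where
    e∈ : (y , x) ∈ edges G
    e∈ = ∈-filter⁺ forwardEdge? (∈-cartesianProduct⁺ (∈-allFin y) (∈-allFin x)) (y<x , symm x~y)

  Ends-disjoint : ∀ {xs e f} → Ends (_∉ xs) e → Ends (_∈ xs) f → EdgeDisjoint e f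
  Ends-disjoint (u∉ , v∉) (x∈ , y∈) = ≢ u∉ x∈ , ≢ u∉ y∈ , ≢ v∉ x∈ , ≢ v∉ y∈
    where
    ≢ : ∀ {xs : List (Fin n)} {u x} → u ∉ xs → x ∈ xs → u ≢ x
    ≢ u∉ x∈ refl = u∉ x∈

  -- Greedy choice from the end of the list: `x` is kept when it has no neighbour in the tail. A
  -- discarded `x` has such a neighbour, and that edge pays for the loss.
  independentSublist : ∀ xs → Unique xs → ∃ λ S →
    All (_∈ xs) S × AllPairs NonAdjacent S × length xs ≤ⁿ length S + edgesIn xs
  independentSublist []       _          = [] , [] , [] , z≤n
  independentSublist (x ∷ xs) (x∉ ∷ xs!)
    with S , S⊆xs , S-ind , size ← independentSublist xs xs! | degreeIn x xs in d≡
  ... | zero  =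
          x ∷ S
        , here refl ∷ All.map there S⊆xs
        , All.map (All.lookup (All.zip (x∉ , degreeIn≡0⇒≁ d≡))) S⊆xs ∷ S-ind
        , s≤s size
  ... | suc d = S , All.map there S⊆xs , S-ind , (begin
    suc (length xs)                     ≤⟨ s≤s size ⟩
    suc (length S + edgesIn xs)         ≡⟨ ℕ.+-suc (length S) _ ⟨
    length S + (1 + edgesIn xs)         ≤⟨ ℕ.+-monoʳ-≤ (length S) (s≤s (ℕ.m≤n+m _ d)) ⟩
    length S + (suc d + edgesIn xs)     ∎)
    where open ℕ.≤-Reasoning

  -- Leaves and edge counts of forests.

  module Forest (acyclic : Acyclic G) where

    open DecMembership (_≟_ {n}) using (_∈?_)

    -- Prolonging a path by a neighbour of its first vertex other than the
    -- second one cannot hit the path again without closing a cycle.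
    longPath : ∀ {x xs} → x ∈ xs → Unique xs → All (λ v → 2 ≤ⁿ degreeIn v xs) xs →
      ∀ k → ∃₂ λ p q → ∃ λ ps →
        p ∈ xs × Linked _~_ (p ∷ q ∷ ps) × Unique (p ∷ q ∷ ps) × length ps ≡ k
    longPath {x} x∈ xs! 2≤d zero =
      let y , y∈ , x~y , y≢x = neighbour-≢ xs! (All.lookup 2≤d x∈) x
      in y , x , [] , y∈ , symm x~y ∷ [-] , (y≢x ∷ []) ∷ [] ∷ [] , refl
    longPath {x} {xs} x∈ xs! 2≤d (suc k)
      with p , q , ps , p∈ , path , p! , len ← longPath x∈ xs! 2≤d k
      with z , z∈ , p~z , z≢q ← neighbour-≢ xs! (All.lookup 2≤d p∈) q
      with z ∈? p ∷ q ∷ ps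
    ... | no z∉                  = z , p , q ∷ ps , z∈ , symm p~z ∷ path , All.¬Any⇒All¬ _ z∉ ∷ p! , cong suc len
    ... | yes (here refl)        = contradiction p~z (irrefl refl)
    ... | yes (there (here z≡q)) = contradiction z≡q z≢q
    ... | yes (there (there z∈ps)) with as , bs , refl ← ∈-∃++ z∈ps =
      contradiction (symm p~z ∷ Linked-++⁻∷ʳ (p ∷ q ∷ as) path , cycle! , s≤s (s≤s z≤n))
                    (acyclic z (p ∷ q ∷ as))
      where
      cycle! : Unique (z ∷ p ∷ q ∷ as)
      cycle! = AllPairs-++⁻ˡ (z ∷ p ∷ q ∷ as) (Unique-resp-↭ (shift z (p ∷ q ∷ as) bs) p!)

    -- Otherwise there is a path with n + 2 distinct vertices.
    leaf : ∀ {x xs} → Unique (x ∷ xs) → ∃₂ λ v ys → x ∷ xs ↭ v ∷ ys × degreeIn v ys ≤ⁿ 1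
    leaf {x} {xs} xs! with any? (λ v → degreeIn v (x ∷ xs) ℕ.≤? 1) (x ∷ xs)
    ... | yes p with v , v∈ , d≤1 ← find p with ys , xs↭ ← ∈⇒↭∷ v∈ =
      v , ys , xs↭ , subst (_≤ⁿ 1) (≡-trans (degreeIn-↭ v xs↭) (degreeIn-self v ys)) d≤1
    ... | no ¬p
      with _ , _ , ps , _ , _ , p! , len ← longPath (here refl) xs! (All.map ℕ.≰⇒> (All.¬Any⇒All¬ _ ¬p)) n =
      contradiction (Unique⇒length≤ p!) (ℕ.<⇒≱ (ℕ.m≤n⇒m≤1+n (s≤s (ℕ.≤-reflexive (sym len)))))

    -- Vertices of degree at most 1 are removed one by one. Each removal costs at most one edge, and
    -- the last vertex spans none.
    edgesIn-forest : ∀ {x xs} → Unique (x ∷ xs) → edgesIn (x ∷ xs) ≤ⁿ length xs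
    edgesIn-forest xs! = go xs! refl
      where
      -- The recursion is on the length, since `leaf` returns the remaining vertices only up to
      -- permutation.
      go : ∀ {k x xs} → Unique (x ∷ xs) → length xs ≡ k → edgesIn (x ∷ xs) ≤ⁿ k
      go {k} xs! len with leaf xs!
      go {zero}  xs! len | v , [] , xs↭ , d≤1 = ℕ.≤-reflexive (edgesIn-↭ xs↭)
      go {zero}  xs! len | v , _ ∷ _ , xs↭ , d≤1
        with () ← ≡-trans (sym (ℕ.suc-injective (↭-length xs↭))) len
      -- The lengths exclude this case, but the bound is immediate anyway, as a single vertex spans
      -- no edge.
      go {suc k} xs! len | v , [] , xs↭ , d≤1 = subst (_≤ⁿ suc k) (sym (edgesIn-↭ xs↭)) z≤n
      go {suc k} xs! len | v , y ∷ ys , xs↭ , d≤1 with _ ∷ ys! ← Unique-resp-↭ xs↭ xs! =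
        subst (_≤ⁿ suc k) (sym (edgesIn-↭ xs↭))
          (ℕ.+-mono-≤ d≤1 (go ys! (ℕ.suc-injective (≡-trans (ℕ.suc-injective (sym (↭-length xs↭))) len))))

    -- Kőnig's inequality for forests.

    -- Confining `S` and `M` to `xs` is what lets the induction extend them: a vertex without
    -- neighbours in `xs` can join `S`, and an edge with both ends outside `xs` can join `M`.
    record KőnigPair (xs : List (Fin n)) : Set where
      field
        {S}   : List (Fin n)
        {M}   : List (Fin (m G))
        S⊆xs  : All (_∈ xs) S
        S-ind : AllPairs NonAdjacent S
        M⊆xs  : All (Ends (_∈ xs)) M
        M-dis : AllPairs EdgeDisjoint M
        size  : length xs ≤ⁿ length S + length M

    KőnigPair-resp-↭ : ∀ {xs ys} → xs ↭ ys → KőnigPair xs → KőnigPair ys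
    KőnigPair-resp-↭ xs↭ys K = record
      { S⊆xs = All.map (∈-resp-↭ xs↭ys) S⊆xs ; S-ind = S-ind
      ; M⊆xs = All.map (λ (u∈ , v∈) → ∈-resp-↭ xs↭ys u∈ , ∈-resp-↭ xs↭ys v∈) M⊆xs ; M-dis = M-dis
      ; size = subst (_≤ⁿ _) (↭-length xs↭ys) size }
      where open KőnigPair K

    add-isolated : ∀ {v ys} → Unique (v ∷ ys) → degreeIn v ys ≡ 0 → KőnigPair ys → KőnigPair (v ∷ ys)
    add-isolated (v∉ ∷ _) d≡0 K = record
      { S⊆xs  = here refl ∷ All.map there S⊆xs
      ; S-ind = All.map (All.lookup (All.zip (v∉ , degreeIn≡0⇒≁ d≡0))) S⊆xs ∷ S-ind
      ; M⊆xs  = All.map (λ (x∈ , y∈) → there x∈ , there y∈) M⊆xs ; M-dis = M-dis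
      ; size  = s≤s size }
      where open KőnigPair K

    -- The leaf `v` joins `S` and the edge from `v` to `u` joins `M`, which accounts for the two
    -- added vertices. As `u` stays out of `S`, nothing in `S` is adjacent to `v`.
    add-leafEdge : ∀ {v u zs} → Unique (v ∷ u ∷ zs) → v ~ u → degreeIn v zs ≡ 0 →
      KőnigPair zs → KőnigPair (v ∷ u ∷ zs)
    add-leafEdge {v} {u} {zs} ((_ ∷ v∉) ∷ u∉ ∷ _) v~u d≡0 K with e , ends ← adjacent⇒edge v~u = record
      { S⊆xs  = here refl ∷ All.map (λ x∈ → there (there x∈)) S⊆xs
      ; S-ind = All.map (All.lookup (All.zip (v∉ , degreeIn≡0⇒≁ d≡0))) S⊆xs ∷ S-ind
      ; M⊆xs  = ends (_∈ v ∷ u ∷ zs) (here refl) (there (here refl))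
              ∷ All.map (λ (x∈ , y∈) → there (there x∈) , there (there y∈)) M⊆xs
      ; M-dis = All.map (Ends-disjoint (ends (_∉ zs) (All.All¬⇒¬Any v∉) (All.All¬⇒¬Any u∉))) M⊆xs ∷ M-dis
      ; size  = s≤s (ℕ.≤-trans (s≤s size) (ℕ.≤-reflexive (sym (ℕ.+-suc _ _)))) }
      where open KőnigPair K

    kőnig : ∀ {xs} → Unique xs → KőnigPair xs
    kőnig {xs} xs! = go (length xs) ℕ.≤-refl xs!
      where
      -- `k` is only an upper bound on the length, because a leaf is removed either alone or
      -- together with its neighbour.
      go : ∀ k {xs} → length xs ≤ⁿ k → Unique xs → KőnigPair xs
      go k       {[]}    _          _   = record { S⊆xs = [] ; S-ind = [] ; M⊆xs = [] ; M-dis = [] ; size = z≤n }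
      go (suc k) {_ ∷ _} (s≤s xs≤k) xs! with leaf xs!
      ... | v , ys , xs↭ , d≤1
        with ys! @ (_ ∷ ys!′) ← Unique-resp-↭ xs↭ xs!
        with ys≤k ← subst (_≤ⁿ k) (ℕ.suc-injective (↭-length xs↭)) xs≤k
        with degreeIn v ys in d≡
      ... | zero = KőnigPair-resp-↭ (↭-sym xs↭) (add-isolated ys! d≡ (go k ys≤k ys!′))
      ... | suc d with u , u∈ , v~u ← neighbour ys d≡ with zs , ys↭ ← ∈⇒↭∷ u∈
        with ys!″ @ (_ ∷ _ ∷ zs!) ← Unique-resp-↭ (prep v ys↭) ys! =
        KőnigPair-resp-↭ (↭-sym (↭-trans xs↭ (prep v ys↭)))
          (add-leafEdge ys!″ v~u d≡0 (go k zs≤k zs!))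
        where
        -- `u` already uses up the single neighbour that `v` may have.
        d≡0 : degreeIn v zs ≡ 0
        d≡0 = ℕ.n≤0⇒n≡0 (s≤s⁻¹ (subst (_≤ⁿ 1)
          (≡-trans (sym d≡) (≡-trans (degreeIn-↭ v ys↭) (degreeIn-adj zs v~u))) d≤1))
        zs≤k : length zs ≤ⁿ k
        zs≤k = ℕ.<⇒≤ (subst (_≤ⁿ k) (↭-length ys↭) ys≤k)

    n≤α+μ : n ≤ⁿ α G + μ G
    n≤α+μ = ℕ.≤-trans (ℕ.≤-trans (ℕ.≤-reflexive (sym (List.length-tabulate id))) size)
                      (ℕ.+-mono-≤ (length≤α S-ind) (length≤μ M-dis))
      where open KőnigPair (kőnig (Unique.allFin⁺ n))

-- The annihilation bound for trees.

-- The first step of a walk from vertex 0 to vertex 1 is an edge at 0, counted in the head term of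
-- `edgesIn`.
connected⇒0<edgesIn : ∀ {n} (G : Graph n) → Connected G → 2 ≤ⁿ n → 0 < Counting.edgesIn G (allFin n)
connected⇒0<edgesIn {suc zero}    G connected (s≤s ())
connected⇒0<edgesIn {suc (suc n)} G connected _ with connected Fin.zero (Fin.suc Fin.zero)
... | _◅_ {j = Fin.zero}  0~0 _ = contradiction 0~0 (Graph.irrefl G refl)
... | _◅_ {j = Fin.suc j} 0~j _ = ℕ.≤-trans (Counting.∈⇒0<degreeIn G (∈-tabulate⁺ {f = Fin.suc} j) 0~j) (ℕ.m≤m+n _ _)

annihilation-bound : ∀ {n} (T : Graph n) → IsTree T → 2 ≤ⁿ n →
  suc (a T + a T) ≤ⁿ α T + α T + μ T
annihilation-bound {n} T tree 2≤n
  -- Pulls the sorted degree sequence back to an ordering `vs` of the vertices by degree, so that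
  -- its initial segments become sets of vertices.
  with vs , ds≡ , all↭vs ← ↭-map-inv (degree T) (↭-sym (sort-↭ ℕ.≤-decTotalOrder (map (degree T) (allFin n))))
  = bound H refl
  where
  open Counting T
  open IsTree tree
  open Forest acyclic

  L = take (a T) vs
  H = drop (a T) vs

  vs! : Unique vs
  vs! = Unique-resp-↭ all↭vs (Unique.allFin⁺ n)

  L++H↭all : allFin n ↭ L ++ H
  L++H↭all = subst (allFin n ↭_) (sym (List.take++drop≡id (a T) vs)) all↭vs

  edgesIn-L≤H : edgesIn L ≤ⁿ edgesIn H
  edgesIn-L≤H = edgesIn-comparison L H (begin
    edgesBetween L (L ++ H)              ≡⟨ edgesBetween-↭ʳ L L++H↭all ⟨
    sum (map (degree T) L)               ≡⟨ cong sum (List.take-map (a T) vs) ⟨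
    sum (take (a T) (map (degree T) vs)) ≡⟨ cong (sum ∘ take (a T)) ds≡ ⟨
    -- `z≤n` is the case k = 0: the empty sum is at most `m T`, so the default value of `greatest≤`
    -- is legitimate.
    sum (take (a T) (degreeSequence T))  ≤⟨ greatest≤-satisfies n (λ k → sum (take k (degreeSequence T)) ℕ.≤? m T) z≤n ⟩
    m T                                  ≤⟨ m≤edgesIn-allFin ⟩
    edgesIn (allFin n)                   ≡⟨ edgesIn-↭ L++H↭all ⟩
    edgesIn (L ++ H)                     ∎)
    where open ℕ.≤-Reasoning

  length-vs : length vs ≡ n
  length-vs = ≡-trans (sym (↭-length all↭vs)) (List.length-tabulate id)

  length-L : length L ≡ a T
  length-L = ≡-trans (List.length-take (a T) vs)
    (ℕ.m≤n⇒m⊓n≡m (subst (a T ≤ⁿ_) (sym length-vs) (greatest≤-≤ n _)))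

  a+∣H∣≡n : a T + length H ≡ n
  a+∣H∣≡n = begin
    a T + length H      ≡⟨ cong (_+ length H) length-L ⟨
    length L + length H ≡⟨ List.length-++ L ⟨
    length (L ++ H)     ≡⟨ ↭-length L++H↭all ⟨
    length (allFin n)   ≡⟨ List.length-tabulate id ⟩
    n                   ∎
    where open ≡-Reasoning

  a≤α+edgesIn-L : a T ≤ⁿ α T + edgesIn L
  a≤α+edgesIn-L with S , _ , S-ind , size ← independentSublist L (AllPairsₚ.take⁺ (a T) vs!) =
    ℕ.≤-trans (ℕ.≤-trans (ℕ.≤-reflexive (sym length-L)) size) (ℕ.+-monoˡ-≤ _ (length≤α S-ind))

  bound : ∀ hs → H ≡ hs → suc (a T + a T) ≤ⁿ α T + α T + μ T
  -- If `H` were empty, `L` would contain every vertex and yet span no edge by `edgesIn-L≤H`.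
  bound [] H≡ = contradiction edgesIn-all≡0 (ℕ.>⇒≢ (connected⇒0<edgesIn T connected 2≤n))
    where
    open ≡-Reasoning
    edgesIn-all≡0 : edgesIn (allFin n) ≡ 0
    edgesIn-all≡0 = begin
      edgesIn (allFin n) ≡⟨ edgesIn-↭ L++H↭all ⟩
      edgesIn (L ++ H)   ≡⟨ cong (λ hs → edgesIn (L ++ hs)) H≡ ⟩
      edgesIn (L ++ [])  ≡⟨ cong edgesIn (List.++-identityʳ L) ⟩
      edgesIn L          ≡⟨ ℕ.n≤0⇒n≡0 (subst (λ hs → edgesIn L ≤ⁿ edgesIn hs) H≡ edgesIn-L≤H) ⟩
      0                  ∎
  bound (h ∷ hs) H≡ = begin
    -- One copy of `a T` is replaced by `α T + edgesIn L`; the other, with the `suc` and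
    -- `length hs`, makes up `n`.
    suc (a T + a T)                       ≤⟨ s≤s (ℕ.+-monoʳ-≤ (a T) a≤α+edgesIn-L) ⟩
    suc (a T + (α T + edgesIn L))         ≤⟨ s≤s (ℕ.+-monoʳ-≤ (a T) (ℕ.+-monoʳ-≤ (α T) edgesIn-L≤∣hs∣)) ⟩
    suc (a T + (α T + length hs))         ≡⟨ rearrange (a T) (α T) (length hs) ⟩
    α T + (a T + suc (length hs))         ≡⟨ cong (λ xs → α T + (a T + length xs)) H≡ ⟨
    α T + (a T + length H)                ≡⟨ cong (λ k → α T + k) a+∣H∣≡n ⟩
    α T + n                               ≤⟨ ℕ.+-monoʳ-≤ (α T) n≤α+μ ⟩
    α T + (α T + μ T)                     ≡⟨ ℕ.+-assoc (α T) _ _ ⟨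
    α T + α T + μ T                       ∎
    where
    open ℕ.≤-Reasoning
    rearrange : ∀ x y z → suc (x + (y + z)) ≡ y + (x + suc z)
    rearrange = solve-∀
    edgesIn-L≤∣hs∣ : edgesIn L ≤ⁿ length hs
    edgesIn-L≤∣hs∣ = ℕ.≤-trans (subst (λ xs → edgesIn L ≤ⁿ edgesIn xs) H≡ edgesIn-L≤H)
      (edgesIn-forest (subst Unique H≡ (AllPairsₚ.drop⁺ (a T) vs!)))

-- The denominators of the two sides are 1 and 4. Cross-multiplication gives 4(x - y) ≤ 2z - 2,
-- which is twice the hypothesis after rearrangement.
halve-bound : ∀ x y z → suc (x + x) ≤ⁿ y + y + z → + x / 1 - + y / 1 ≤ + z / 2 - ½
halve-bound x y z le = *≤* (ℤ.0≤i-j⇒j≤i (subst (ℤ.0ℤ ℤ.≤_) (rearrange (+ x) (+ y) (+ z))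
  (ℤ.*-monoˡ-≤-nonNeg (+ 2) (ℤ.i≤j⇒0≤j-i (ℤ.+≤+ le)))))
  where
  rearrange : ∀ i j k → + 2 ℤ.* (j ℤ.+ j ℤ.+ k ℤ.- (+ 1 ℤ.+ (i ℤ.+ i))) ≡
    (k ℤ.* + 2 ℤ.+ ℤ.- + 1 ℤ.* + 2) ℤ.* + 1 ℤ.- (i ℤ.* + 1 ℤ.+ ℤ.- j ℤ.* + 1) ℤ.* + 4
  rearrange = ℤ-Solver.solve-∀

-- The one-vertex tree has `a` = `α` = 1 and `μ` = 0, for which the inequality would read 0 ≤ -1/2;
-- hence the assumption of two vertices.
theorem2p4 : ∀ {n : ℕ} (T : Graph n) → IsTree T → 2 ≤ⁿ n →
    + a T / 1 - + α T / 1 ≤ + μ T / 2 - ½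
theorem2p4 T tree 2≤n = halve-bound (a T) (α T) (μ T) (annihilation-bound T tree 2≤n)
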